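{- The equation $x^3=4(x^2+x+1)$ has a unique real solution $R\approx 4.967$, and the competitive ratio of any deterministic preemptive online algorithm for the maximum weight matching problem is at least $R$. That is, for every deterministic preemptive online algorithm and every real $c<R$, there is an input sequence of weighted edges on which the weight of a maximum weight matching of the input graph exceeds $c$ times the weight of the matching held by the algorithm at the end.
   Context: Maximum weight matching: given a finite undirected graph $G=(V,E)$ with non-negative edge weights $w:E\to\mathbb{R}_+$, a matching is a set of edges no two of which share a vertex, its weight is the sum of the weights of its edges, and the goal is to maximize this weight. Preemptive online model: the graph (including its size) is not known in advance. Edges are presented one by one together with their weights. The algorithm maintains a current set of edges which must be a matching at all times. When an edge is presented, the algorithm must decide immediately whether to accept it into the current matching or reject it; at any point in time it may remove (preempt) previously accepted edges from the current matching. An edge that was rejected or preempted can never be inserted into the matching later. There is no restriction on the computation time or on the additional memory used by the algorithm to record information about the past. The output is the matching held at the end of the input. The competitive ratio of an algorithm is the infimum of all $c$ such that for every input sequence the maximum weight of a matching in the input graph is at most $c$ times the weight of the algorithm's output (it is $+\infty$ if no such $c$ exists). -}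

module Defs where

open import Data.Fin.Subset using (Subset; inside; outside; _∈_; _⊆_)
open import Data.Integer.Base using (+_)
open import Data.List.Base using (List; []; _∷_; length; lookup)
open import Data.List.Relation.Unary.AllPairs using (AllPairs)
open import Data.Nat.Base as ℕ using (ℕ; zero; suc; _⊔_)
import Data.Nat.Properties as ℕ
open import Data.Product.Base using (∃; _×_; _,_)
open import Data.Rational as ℚ using (ℚ; 0ℚ; 1ℚ; ½; ∣_∣)
import Data.Rational.Properties as ℚ
open import Data.Rational.Solver using (module +-*-Solver)
open import Data.Sum.Base using (_⊎_)
open import Data.Vec.Base as Vec using ([]; _∷_)
open import Relation.Binary.PropositionalEquality
  using (_≡_; _≢_; refl; sym; trans; cong; subst)
open import Relation.Nullary.Negation.Core using (¬_)

-- Real numbers: Cauchy sequences of rationals, taken up to _≃_.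
IsCauchy : (ℕ → ℚ) → Set
IsCauchy s = ∀ ε → 0ℚ ℚ.< ε →
  ∃ λ N → ∀ m n → N ℕ.≤ m → N ℕ.≤ n → ∣ s m ℚ.- s n ∣ ℚ.< ε

record ℝ : Set where
  constructor mkℝ
  field
    seq    : ℕ → ℚ
    cauchy : IsCauchy seq

open ℝ public

infix  4 _≃_ _<_ _≤_
infixl 6 _+_
infixl 7 _*_
infixr 8 _^_

_≃_ : ℝ → ℝ → Set
x ≃ y = ∀ ε → 0ℚ ℚ.< ε →
  ∃ λ N → ∀ n → N ℕ.≤ n → ∣ seq x n ℚ.- seq y n ∣ ℚ.< ε

-- Strict inequality demands a uniform positive gap; a termwise strict
-- inequality would not respect _≃_.
_<_ : ℝ → ℝ → Set
x < y = ∃ λ ε → 0ℚ ℚ.< ε × ∃ λ N → ∀ n → N ℕ.≤ n → seq x n ℚ.+ ε ℚ.< seq y n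

_≤_ : ℝ → ℝ → Set
x ≤ y = ¬ (y < x)

fromℚ : ℚ → ℝ
fromℚ q = mkℝ (λ _ → q) λ ε 0<ε → 0 , λ _ _ _ _ →
  subst (ℚ._< ε) (sym (cong ∣_∣ (ℚ.+-inverseʳ q))) 0<ε

0ℝ 1ℝ 4ℝ : ℝ
0ℝ = fromℚ 0ℚ
1ℝ = fromℚ 1ℚ
4ℝ = fromℚ (+ 4 ℚ./ 1)

private
  open ℚ.≤-Reasoning
  open +-*-Solver using (solve; _:+_; _:*_; _:-_; _:=_)

∣∣-split : ∀ p q r → p ≡ q ℚ.+ r → ∣ p ∣ ℚ.≤ ∣ q ∣ ℚ.+ ∣ r ∣
∣∣-split p q r refl = ℚ.∣p+q∣≤∣p∣+∣q∣ q r

half+half : ∀ ε → ½ ℚ.* ε ℚ.+ ½ ℚ.* ε ≡ ε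
half+half ε = trans (sym (ℚ.*-distribʳ-+ ε ½ ½)) (ℚ.*-identityˡ ε)

half-pos : ∀ {ε} → 0ℚ ℚ.< ε → 0ℚ ℚ.< ½ ℚ.* ε
half-pos {ε} 0<ε =
  subst (ℚ._< ½ ℚ.* ε) (ℚ.*-zeroʳ ½) (ℚ.*-monoʳ-<-pos ½ {0ℚ} {ε} 0<ε)

+-cauchy : ∀ s t → IsCauchy s → IsCauchy t → IsCauchy (λ n → s n ℚ.+ t n)
+-cauchy s t cs ct ε 0<ε
  with M , s-close ← cs (½ ℚ.* ε) (half-pos 0<ε)
     | N , t-close ← ct (½ ℚ.* ε) (half-pos 0<ε)
  = M ⊔ N , λ m n m≥ n≥ → begin-strict
    ∣ (s m ℚ.+ t m) ℚ.- (s n ℚ.+ t n) ∣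
      ≤⟨ ∣∣-split _ (s m ℚ.- s n) (t m ℚ.- t n)
           (solve 4 (λ a b c d → (a :+ b) :- (c :+ d) := (a :- c) :+ (b :- d))
             refl (s m) (t m) (s n) (t n)) ⟩
    ∣ s m ℚ.- s n ∣ ℚ.+ ∣ t m ℚ.- t n ∣
      <⟨ ℚ.+-mono-<
           (s-close m n (ℕ.≤-trans (ℕ.m≤m⊔n M N) m≥) (ℕ.≤-trans (ℕ.m≤m⊔n M N) n≥))
           (t-close m n (ℕ.≤-trans (ℕ.m≤n⊔m M N) m≥) (ℕ.≤-trans (ℕ.m≤n⊔m M N) n≥)) ⟩
    ½ ℚ.* ε ℚ.+ ½ ℚ.* ε
      ≡⟨ half+half ε ⟩
    ε ∎

eventually-bounded : ∀ {s} → IsCauchy s →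
  ∃ λ K → 0ℚ ℚ.< K × ∃ λ N → ∀ n → N ℕ.≤ n → ∣ s n ∣ ℚ.≤ K
eventually-bounded {s} cs with N , close ← cs 1ℚ (ℚ.positive⁻¹ 1ℚ)
  = 1ℚ ℚ.+ ∣ s N ∣
  , ℚ.+-mono-<-≤ (ℚ.positive⁻¹ 1ℚ) (ℚ.0≤∣p∣ (s N))
  , N
  , λ n n≥ → begin
    ∣ s n ∣
      ≤⟨ ∣∣-split _ (s n ℚ.- s N) (s N)
           (solve 2 (λ a b → a := (a :- b) :+ b) refl (s n) (s N)) ⟩
    ∣ s n ℚ.- s N ∣ ℚ.+ ∣ s N ∣
      ≤⟨ ℚ.+-monoˡ-≤ ∣ s N ∣ (ℚ.<⇒≤ (close n N n≥ ℕ.≤-refl)) ⟩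
    1ℚ ℚ.+ ∣ s N ∣ ∎

divide : ∀ ε K → 0ℚ ℚ.< ε → 0ℚ ℚ.< K → ∃ λ δ → 0ℚ ℚ.< δ × K ℚ.* δ ≡ ε
divide ε K 0<ε 0<K =
  ℚ.1/ K ℚ.* ε
  , subst (ℚ._< ℚ.1/ K ℚ.* ε) (ℚ.*-zeroʳ (ℚ.1/ K))
      (ℚ.*-monoʳ-<-pos (ℚ.1/ K) {0ℚ} {ε} 0<ε)
  , trans (sym (ℚ.*-assoc K (ℚ.1/ K) ε))
      (trans (cong (ℚ._* ε) (ℚ.*-inverseʳ K)) (ℚ.*-identityˡ ε))
  where
  instance
    K>0 : ℚ.Positive K
    K>0 = ℚ.positive 0<K
    K≢0 : ℚ.NonZero K
    K≢0 = ℚ.pos⇒nonZero K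
    1/K>0 : ℚ.Positive (ℚ.1/ K)
    1/K>0 = ℚ.1/pos⇒pos K

bounded*small : ∀ p q K δ → 0ℚ ℚ.< K → ∣ p ∣ ℚ.≤ K → ∣ q ∣ ℚ.< δ →
  ∣ p ℚ.* q ∣ ℚ.< K ℚ.* δ
bounded*small p q K δ 0<K p≤K q<δ = begin-strict
  ∣ p ℚ.* q ∣       ≡⟨ ℚ.∣p*q∣≡∣p∣*∣q∣ p q ⟩
  ∣ p ∣ ℚ.* ∣ q ∣   ≤⟨ ℚ.*-monoʳ-≤-nonNeg ∣ q ∣ {{ℚ.nonNegative (ℚ.0≤∣p∣ q)}} p≤K ⟩
  K ℚ.* ∣ q ∣       <⟨ ℚ.*-monoʳ-<-pos K {{ℚ.positive 0<K}} q<δ ⟩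
  K ℚ.* δ           ∎

product-difference : ∀ a b c d →
  a ℚ.* b ℚ.- c ℚ.* d ≡ a ℚ.* (b ℚ.- d) ℚ.+ d ℚ.* (a ℚ.- c)
product-difference =
  solve 4 (λ a b c d → a :* b :- c :* d := a :* (b :- d) :+ d :* (a :- c)) refl

product-close : ∀ a b c d K L δ → 0ℚ ℚ.< K → 0ℚ ℚ.< L →
  ∣ a ∣ ℚ.≤ K → ∣ d ∣ ℚ.≤ L → ∣ a ℚ.- c ∣ ℚ.< δ → ∣ b ℚ.- d ∣ ℚ.< δ →
  ∣ a ℚ.* b ℚ.- c ℚ.* d ∣ ℚ.< (K ℚ.+ L) ℚ.* δ
product-close a b c d K L δ 0<K 0<L a≤K d≤L ac<δ bd<δ = begin-strict
  ∣ a ℚ.* b ℚ.- c ℚ.* d ∣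
    ≤⟨ ∣∣-split (a ℚ.* b ℚ.- c ℚ.* d) (a ℚ.* (b ℚ.- d)) (d ℚ.* (a ℚ.- c))
         (product-difference a b c d) ⟩
  ∣ a ℚ.* (b ℚ.- d) ∣ ℚ.+ ∣ d ℚ.* (a ℚ.- c) ∣
    <⟨ ℚ.+-mono-< (bounded*small a (b ℚ.- d) K δ 0<K a≤K bd<δ)
                  (bounded*small d (a ℚ.- c) L δ 0<L d≤L ac<δ) ⟩
  K ℚ.* δ ℚ.+ L ℚ.* δ
    ≡⟨ ℚ.*-distribʳ-+ δ K L ⟨
  (K ℚ.+ L) ℚ.* δ ∎

*-cauchy : ∀ s t → IsCauchy s → IsCauchy t → IsCauchy (λ n → s n ℚ.* t n)
*-cauchy s t cs ct ε 0<ε =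
  let K , 0<K , M₁ , s≤K = eventually-bounded cs
      L , 0<L , M₂ , t≤L = eventually-bounded ct
      δ , 0<δ , [K+L]δ≡ε = divide ε (K ℚ.+ L) 0<ε (ℚ.+-mono-< {0ℚ} {K} {0ℚ} {L} 0<K 0<L)
      N₁ , s-close = cs δ 0<δ
      N₂ , t-close = ct δ 0<δ
  in (M₁ ⊔ M₂) ⊔ (N₁ ⊔ N₂) , λ m n m≥ n≥ →
    let m≥M = ℕ.m⊔n≤o⇒m≤o (M₁ ⊔ M₂) (N₁ ⊔ N₂) m≥
        m≥N = ℕ.m⊔n≤o⇒n≤o (M₁ ⊔ M₂) (N₁ ⊔ N₂) m≥
        n≥M = ℕ.m⊔n≤o⇒m≤o (M₁ ⊔ M₂) (N₁ ⊔ N₂) n≥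
        n≥N = ℕ.m⊔n≤o⇒n≤o (M₁ ⊔ M₂) (N₁ ⊔ N₂) n≥
    in subst (∣ s m ℚ.* t m ℚ.- s n ℚ.* t n ∣ ℚ.<_) [K+L]δ≡ε
         (product-close (s m) (t m) (s n) (t n) K L δ 0<K 0<L
           (s≤K m (ℕ.m⊔n≤o⇒m≤o M₁ M₂ m≥M))
           (t≤L n (ℕ.m⊔n≤o⇒n≤o M₁ M₂ n≥M))
           (s-close m n (ℕ.m⊔n≤o⇒m≤o N₁ N₂ m≥N) (ℕ.m⊔n≤o⇒m≤o N₁ N₂ n≥N))
           (t-close m n (ℕ.m⊔n≤o⇒n≤o N₁ N₂ m≥N) (ℕ.m⊔n≤o⇒n≤o N₁ N₂ n≥N)))

_+_ : ℝ → ℝ → ℝ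
x + y = mkℝ (λ n → seq x n ℚ.+ seq y n) (+-cauchy (seq x) (seq y) (cauchy x) (cauchy y))

_*_ : ℝ → ℝ → ℝ
x * y = mkℝ (λ n → seq x n ℚ.* seq y n) (*-cauchy (seq x) (seq y) (cauchy x) (cauchy y))

_^_ : ℝ → ℕ → ℝ
x ^ zero  = 1ℝ
x ^ suc n = x * x ^ n

-- Vertices are named by natural numbers.  The unordered pair {u, v} is
-- stored in increasing order, which also excludes loops.
record Edge : Set where
  constructor mkEdge
  field
    u v      : ℕ
    u<v      : u ℕ.< v
    weight   : ℝ
    weight≥0 : 0ℝ ≤ weight

open Edge public

_∈ᵉ_ : ℕ → Edge → Set
x ∈ᵉ e = x ≡ u e ⊎ x ≡ v e

Disjoint : Edge → Edge → Set
Disjoint e f = ∀ x → x ∈ᵉ e → ¬ (x ∈ᵉ f)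

-- The edges presented so far, most recent first: e ∷ σ is the input σ
-- followed by the arrival of e.
Input : Set
Input = List Edge

IsSimple : Input → Set
IsSimple = AllPairs λ e f → ¬ (u e ≡ u f × v e ≡ v f)

IsMatching : (σ : Input) → Subset (length σ) → Set
IsMatching σ M = ∀ i j → i ∈ M → j ∈ M → i ≢ j → Disjoint (lookup σ i) (lookup σ j)

totalWeight : (σ : Input) → Subset (length σ) → ℝ
totalWeight []      []            = 0ℝ
totalWeight (e ∷ σ) (inside  ∷ M) = weight e + totalWeight σ M
totalWeight (e ∷ σ) (outside ∷ M) = totalWeight σ M

IsMaximumMatching : (σ : Input) → Subset (length σ) → Set
IsMaximumMatching σ M =
  IsMatching σ M × (∀ M′ → IsMatching σ M′ → totalWeight σ M′ ≤ totalWeight σ M)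

-- `held σ` is the set of edges held once exactly the edges of σ have been
-- presented.  Being a function of the whole past, it models unrestricted
-- memory and computation.  By `irrevocable`, an edge presented before the
-- latest arrival is held only if it was held before that arrival.
-- Values of `held` on inputs that are not simple graphs are irrelevant.
record OnlineAlgorithm : Set where
  field
    held        : (σ : Input) → Subset (length σ)
    matching    : ∀ σ → IsSimple σ → IsMatching σ (held σ)
    irrevocable : ∀ e σ → IsSimple (e ∷ σ) → Vec.tail (held (e ∷ σ)) ⊆ held σ

open OnlineAlgorithm public

IsCompetitive : OnlineAlgorithm → ℝ → Set
IsCompetitive A c = ∀ σ → IsSimple σ → ∀ M → IsMaximumMatching σ M →
  totalWeight σ M ≤ c * totalWeight σ (held A σ)

-- The competitive ratio is the infimum, possibly +∞, of the c for which A
-- is c-competitive; it is at least r iff r is a lower bound of these c.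
CompetitiveRatio≥ : OnlineAlgorithm → ℝ → Set
CompetitiveRatio≥ A r = ∀ c → IsCompetitive A c → r ≤ c

module Submission where

-- No algorithm is 5-competitive even for integer weights, and R < 5.
--
-- While the algorithm holds e = {a, b} of weight w, and a matching F of weight S
-- avoids a and b, the adversary presents pendant edges of weights 1, 1, 2, 2, 3, 3, …
-- alternately at a and at b. As long as they are rejected up to weight t, the
-- matching F plus one pendant edge on each side has weight S + 2t, so some edge
-- must be accepted while S + 2t ≤ 5w. If the one of weight t + 1 is accepted, it
-- becomes the new e, and F grows by the rejected pendant edge of weight ≥ t at the
-- other end of the old e; moreover S + w ≤ 5(t + 1), since otherwise F together with
-- the old e already wins, so weights drop at most by a factor 5 per round. The ratio S/w becomes at least (S + t)/(t + 1), which
-- exceeds S/w by at least 1/12 when w ≥ 37; after 49 such rounds S > 4w, and then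
-- F together with e wins.

open import Data.Empty using (⊥)
open import Data.Fin.Base using (zero; suc)
open import Data.Fin.Properties as Fin using (all?)
open import Data.Fin.Subset as Subset using (Subset; inside; outside; _∈_; _⊆_)
open import Data.Fin.Subset.Properties using (anySubset?; drop-∷-⊆; ⊆⊤; _∈?_)
open import Data.Integer.Base as ℤ using (+_; +[1+_])
import Data.Integer.Properties as ℤ
open import Data.List.Base using ([]; _∷_; length; lookup)
open import Data.List.Membership.Propositional.Properties using (∈-lookup)
open import Data.List.Relation.Unary.All as All using (All; []; _∷_)
open import Data.List.Relation.Unary.AllPairs using ([]; _∷_)
open import Data.Nat.Base as ℕ using (ℕ; zero; suc; _⊔_; z≤n; s≤s)
import Data.Nat.Properties as ℕ
open import Data.Nat.Tactic.RingSolver using (solve-∀)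
open import Data.Product.Base using (∃; _×_; _,_; proj₁; proj₂)
open import Data.Rational as ℚ using (ℚ; mkℚ; 0ℚ; 1ℚ; ½; ∣_∣; _/_; toℚᵘ)
import Data.Rational.Properties as ℚ
open import Data.Rational.Solver using (module +-*-Solver)
open import Data.Rational.Unnormalised.Base as ℚᵘ using (mkℚᵘ; *≡*; *≤*)
import Data.Rational.Unnormalised.Properties as ℚᵘ
open import Data.Sum.Base using (_⊎_; inj₁; inj₂; [_,_])
open import Data.Vec.Base as Vec using ([]; _∷_; here; there)
open import Function.Base using (_∘_; id)
open import Relation.Binary.PropositionalEquality
  using (_≡_; _≢_; refl; sym; trans; cong; cong₂; subst)
open import Relation.Nullary using (Dec; yes; no; ¬_; contradiction)
open import Relation.Nullary.Decidable
  using (from-no; from-yes; map′; ¬?; _×-dec_; _⊎-dec_; _→-dec_)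
open +-*-Solver using (solve; con; _:+_; _:*_; _:-_; :-_; _:=_)

-- Arithmetic of a single round

module Gain where
  open import Data.Nat.Base using (_+_; _*_; _≤_)
  open ℕ.≤-Reasoning

  2mn≤m²+n² : ∀ m n → 2 * (m * n) ≤ m * m + n * n
  2mn≤m²+n² m n with ℕ.≤-total m n
  ... | inj₁ m≤n with d , refl ← ℕ.m≤n⇒∃[o]m+o≡n m≤n = begin
    2 * (m * (m + d))             ≤⟨ ℕ.m≤m+n _ (d * d) ⟩
    2 * (m * (m + d)) + d * d     ≡⟨ identity m d ⟩
    m * m + (m + d) * (m + d)     ∎
    where
    identity : ∀ m d → 2 * (m * (m + d)) + d * d ≡ m * m + (m + d) * (m + d)
    identity = solve-∀
  ... | inj₂ n≤m with d , refl ← ℕ.m≤n⇒∃[o]m+o≡n n≤m = begin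
    2 * ((n + d) * n)             ≤⟨ ℕ.m≤m+n _ (d * d) ⟩
    2 * ((n + d) * n) + d * d     ≡⟨ identity n d ⟩
    (n + d) * (n + d) + n * n     ∎
    where
    identity : ∀ n d → 2 * ((n + d) * n) + d * d ≡ (n + d) * (n + d) + n * n
    identity = solve-∀

  -- The squares of 3w - 4a and w - a are nonnegative; adding them gives even 26wa on the left.
  25wa≤10w²+17a² : ∀ w a → 25 * (w * a) ≤ 10 * (w * w) + 17 * (a * a)
  25wa≤10w²+17a² w a = begin
    25 * (w * a)
      ≤⟨ ℕ.m≤n+m _ (w * a) ⟩
    w * a + 25 * (w * a)
      ≡⟨ identity₁ w a ⟩
    2 * (3 * w * (4 * a)) + 2 * (w * a)
      ≤⟨ ℕ.+-mono-≤ (2mn≤m²+n² (3 * w) (4 * a)) (2mn≤m²+n² w a) ⟩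
    (3 * w * (3 * w) + 4 * a * (4 * a)) + (w * w + a * a)
      ≡⟨ identity₂ w a ⟩
    10 * (w * w) + 17 * (a * a) ∎
    where
    identity₁ : ∀ w a → w * a + 25 * (w * a) ≡ 2 * (3 * w * (4 * a)) + 2 * (w * a)
    identity₁ = solve-∀
    identity₂ : ∀ w a → (3 * w * (3 * w) + 4 * a * (4 * a)) + (w * w + a * a)
                        ≡ 10 * (w * w) + 17 * (a * a)
    identity₂ = solve-∀

  -- 12 (S+t)/(t+1) ≥ 12 S/w + 1 with denominators cleared.
  gain-cleared : ∀ S w t → 37 ≤ w → S + (t + t) ≤ 5 * w → S + w ≤ 5 * suc t →
                 (12 * S + w) * suc t ≤ 12 * (S + t) * w
  gain-cleared S w t 37≤w S+2t≤5w S+w≤5t⁺ with ℕ.<-≤-connex t w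
  gain-cleared S w zero 37≤w _ S+w≤5 | inj₁ _ =
    contradiction (ℕ.≤-trans (ℕ.≤-trans 37≤w (ℕ.m≤n+m w S)) S+w≤5) (from-no (37 ℕ.≤? 5))
  gain-cleared S w t@(suc t-1) 37≤w _ _ | inj₁ t⁺≤w = begin
    (12 * S + w) * suc t          ≡⟨ ℕ.*-distribʳ-+ (suc t) (12 * S) w ⟩
    12 * S * suc t + w * suc t    ≤⟨ ℕ.+-mono-≤ (ℕ.*-monoʳ-≤ (12 * S) t⁺≤w)
                                       (ℕ.*-monoʳ-≤ w t⁺≤12t) ⟩
    12 * S * w + w * (12 * t)     ≡⟨ identity S w t ⟩
    12 * (S + t) * w              ∎
    where
    identity : ∀ S w t → 12 * S * w + w * (12 * t) ≡ 12 * (S + t) * w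
    identity = solve-∀
    split : ∀ k → 2 + k + (10 + 11 * k) ≡ 12 * suc k
    split = solve-∀
    t⁺≤12t : suc t ≤ 12 * t
    t⁺≤12t = ℕ.≤-trans (ℕ.m≤m+n (suc t) (10 + 11 * t-1)) (ℕ.≤-reflexive (split t-1))
  gain-cleared S w t 37≤w S+2t≤5w _ | inj₂ w≤t with a , refl ← ℕ.m≤n⇒∃[o]m+o≡n w≤t =
    -- Here t = w + a. The added term completes S to S + 2a, which `S + 2t ≤ 5w` caps at 3w. The
    -- terms linear in w then sum to 37w, absorbed by w²: this is where the threshold 37 comes from.
    ℕ.+-cancelʳ-≤ (24 * (a * suc a)) _ _ (begin
    (12 * S + w) * suc (w + a) + 24 * (a * suc a)
      ≡⟨ identity₁ S w a ⟩
    12 * S * w + w * w + w * a + w + 12 * suc a * (S + 2 * a)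
      ≤⟨ ℕ.+-monoʳ-≤ (12 * S * w + w * w + w * a + w) (ℕ.*-monoʳ-≤ (12 * suc a) S+2a≤3w) ⟩
    12 * S * w + w * w + w * a + w + 12 * suc a * (3 * w)
      ≡⟨ identity₂ S w a ⟩
    12 * S * w + w * w + 12 * (w * a) + (37 * w + 25 * (w * a))
      ≤⟨ ℕ.+-monoʳ-≤ (12 * S * w + w * w + 12 * (w * a))
           (ℕ.+-mono-≤ (ℕ.*-monoˡ-≤ w 37≤w) (25wa≤10w²+17a² w a)) ⟩
    12 * S * w + w * w + 12 * (w * a) + (w * w + (10 * (w * w) + 17 * (a * a)))
      ≤⟨ ℕ.m≤m+n _ (7 * (a * a) + 24 * a) ⟩
    12 * S * w + w * w + 12 * (w * a) + (w * w + (10 * (w * w) + 17 * (a * a)))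
      + (7 * (a * a) + 24 * a)
      ≡⟨ identity₃ S w a ⟩
    12 * (S + (w + a)) * w + 24 * (a * suc a) ∎)
    where
    identity₀ : ∀ S w a → S + 2 * a + 2 * w ≡ S + (w + a + (w + a))
    identity₀ = solve-∀
    identity₀′ : ∀ w → 5 * w ≡ 3 * w + 2 * w
    identity₀′ = solve-∀
    S+2a≤3w : S + 2 * a ≤ 3 * w
    S+2a≤3w = ℕ.+-cancelʳ-≤ (2 * w) _ _ (begin
      S + 2 * a + 2 * w          ≡⟨ identity₀ S w a ⟩
      S + (w + a + (w + a))      ≤⟨ S+2t≤5w ⟩
      5 * w                      ≡⟨ identity₀′ w ⟩
      3 * w + 2 * w              ∎)
    identity₁ : ∀ S w a → (12 * S + w) * suc (w + a) + 24 * (a * suc a)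
                ≡ 12 * S * w + w * w + w * a + w + 12 * suc a * (S + 2 * a)
    identity₁ = solve-∀
    identity₂ : ∀ S w a → 12 * S * w + w * w + w * a + w + 12 * suc a * (3 * w)
                ≡ 12 * S * w + w * w + 12 * (w * a) + (37 * w + 25 * (w * a))
    identity₂ = solve-∀
    identity₃ : ∀ S w a →
      12 * S * w + w * w + 12 * (w * a) + (w * w + (10 * (w * w) + 17 * (a * a)))
        + (7 * (a * a) + 24 * a)
      ≡ 12 * (S + (w + a)) * w + 24 * (a * suc a)
    identity₃ = solve-∀

  -- The premise on `i` reads S/w ≥ i/12, and the next pair (S + t, t + 1) satisfies it with i + 1.
  -- Multiplying by w reduces this to `gain-cleared`.
  gain : ∀ i S w t → 37 ≤ w → S + (t + t) ≤ 5 * w → S + w ≤ 5 * suc t →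
         i * w ≤ 12 * S → suc i * suc t ≤ 12 * (S + t)
  gain i S zero t ()
  gain i S w@(suc _) t 37≤w S+2t≤5w S+w≤5t⁺ iw≤12S = ℕ.*-cancelʳ-≤ _ _ w (begin
    suc i * suc t * w        ≡⟨ identity i t w ⟩
    (i * w + w) * suc t      ≤⟨ ℕ.*-monoˡ-≤ (suc t) (ℕ.+-monoˡ-≤ w iw≤12S) ⟩
    (12 * S + w) * suc t     ≤⟨ gain-cleared S w t 37≤w S+2t≤5w S+w≤5t⁺ ⟩
    12 * (S + t) * w         ∎)
    where
    identity : ∀ i t w → suc i * suc t * w ≡ (i * w + w) * suc t
    identity = solve-∀

open import Defs

-- Naturals as rationals

-- Recursion, in place of a quotient, makes the homomorphism laws plain inductions with no
-- normalisation of fractions.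
ι : ℕ → ℚ
ι zero    = 0ℚ
ι (suc n) = 1ℚ ℚ.+ ι n

ι-homo-+ : ∀ m n → ι (m ℕ.+ n) ≡ ι m ℚ.+ ι n
ι-homo-+ zero    n = sym (ℚ.+-identityˡ (ι n))
ι-homo-+ (suc m) n = trans (cong (1ℚ ℚ.+_) (ι-homo-+ m n)) (sym (ℚ.+-assoc 1ℚ (ι m) (ι n)))

0≤ι : ∀ n → 0ℚ ℚ.≤ ι n
0≤ι zero    = ℚ.≤-refl
0≤ι (suc n) = ℚ.+-mono-≤ (ℚ.nonNegative⁻¹ 1ℚ) (0≤ι n)

ι-mono-≤ : ∀ {m n} → m ℕ.≤ n → ι m ℚ.≤ ι n
ι-mono-≤ {n = n} z≤n = 0≤ι n
ι-mono-≤ (s≤s m≤n)   = ℚ.+-monoʳ-≤ 1ℚ (ι-mono-≤ m≤n)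

ι-homo-* : ∀ m n → ι (m ℕ.* n) ≡ ι m ℚ.* ι n
ι-homo-* zero    n = sym (ℚ.*-zeroˡ (ι n))
ι-homo-* (suc m) n = trans (ι-homo-+ n (m ℕ.* n)) (trans (cong (ι n ℚ.+_) (ι-homo-* m n))
  (solve 2 (λ m n → n :+ m :* n := (con 1ℚ :+ m) :* n) refl (ι m) (ι n)))

toℚᵘ-ι : ∀ n → toℚᵘ (ι n) ℚᵘ.≃ mkℚᵘ (+ n) 0
toℚᵘ-ι zero    = *≡* refl
toℚᵘ-ι (suc n) = ℚᵘ.≃-trans (ℚ.toℚᵘ-homo-+ 1ℚ (ι n))
  (ℚᵘ.≃-trans (ℚᵘ.+-cong (ℚᵘ.≃-refl {toℚᵘ 1ℚ}) (toℚᵘ-ι n))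
    (*≡* (cong (λ i → (+ 1 ℤ.+ i) ℤ.* + 1) (ℤ.*-identityʳ (+ n)))))

-- The denominator of ε serves as N: the product is then the numerator, which is at least 1.
archimedean : ∀ ε → {{ℚ.Positive ε}} → ∃ λ N → 1ℚ ℚ.≤ ι N ℚ.* ε
archimedean ε@(mkℚ +[1+ k ] d _) = suc d , ℚ.toℚᵘ-cancel-≤ (begin
  mkℚᵘ (+ 1) 0                        ≤⟨ *≤* (ℤ.+≤+ numerators) ⟩
  mkℚᵘ (+ suc d) 0 ℚᵘ.* toℚᵘ ε        ≃⟨ ℚᵘ.*-cong (toℚᵘ-ι (suc d)) (ℚᵘ.≃-refl {toℚᵘ ε}) ⟨
  toℚᵘ (ι (suc d)) ℚᵘ.* toℚᵘ ε        ≃⟨ ℚ.toℚᵘ-homo-* (ι (suc d)) ε ⟨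
  toℚᵘ (ι (suc d) ℚ.* ε)              ∎)
  where
  open ℚᵘ.≤-Reasoning
  numerators : 1 ℕ.* (1 ℕ.* suc d) ℕ.≤ suc d ℕ.* suc k ℕ.* 1
  numerators = ℕ.≤-trans
    (ℕ.≤-reflexive (trans (ℕ.*-identityˡ _) (ℕ.*-identityˡ (suc d))))
    (ℕ.≤-trans (ℕ.m≤m*n (suc d) (suc k)) (ℕ.≤-reflexive (sym (ℕ.*-identityʳ _))))

-- The root of the cubic

4ℚ 8ℚ 12ℚ 20ℚ 1/32 : ℚ
4ℚ = + 4 / 1
8ℚ = + 8 / 1
12ℚ = + 12 / 1
20ℚ = + 20 / 1
1/32 = + 1 / 32

-- The trailing factors `1ℚ` mirror the unfolding of `_^_`, so that this is definitionally a term of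
-- the difference of the two sides of the equation over `ℝ`.
cubic : ℚ → ℚ
cubic x = x ℚ.* (x ℚ.* (x ℚ.* 1ℚ)) ℚ.- 4ℚ ℚ.* (x ℚ.* (x ℚ.* 1ℚ) ℚ.+ x ℚ.+ 1ℚ)

-- P a is x³ − 4(x² + x + 1) at x = 4 + a. Since a root has a > 0, where all terms
-- of the difference quotient Q are positive, P is strictly increasing there.
P : ℚ → ℚ
P a = a ℚ.* (a ℚ.* (a ℚ.+ 8ℚ) ℚ.+ 12ℚ) ℚ.- 20ℚ

Q : ℚ → ℚ → ℚ
Q a b = 12ℚ ℚ.+ (8ℚ ℚ.* (a ℚ.+ b) ℚ.+ (a ℚ.* a ℚ.+ a ℚ.* b ℚ.+ b ℚ.* b))

P-difference : ∀ a b → P a ℚ.- P b ≡ (a ℚ.- b) ℚ.* Q a b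
P-difference = solve 2 (λ a b →
  (a :* (a :* (a :+ con 8ℚ) :+ con 12ℚ) :- con 20ℚ) :- (b :* (b :* (b :+ con 8ℚ) :+ con 12ℚ) :- con 20ℚ)
  := (a :- b) :* (con 12ℚ :+ (con 8ℚ :* (a :+ b) :+ (a :* a :+ a :* b :+ b :* b)))) refl

cubic-4+ : ∀ a → cubic (4ℚ ℚ.+ a) ≡ P a
cubic-4+ = solve 1 (λ a → let x = con 4ℚ :+ a in
  x :* (x :* (x :* con 1ℚ)) :- con 4ℚ :* (x :* (x :* con 1ℚ) :+ x :+ con 1ℚ)
  := a :* (a :* (a :+ con 8ℚ) :+ con 12ℚ) :- con 20ℚ) refl

0≤p+q : ∀ {p q} → 0ℚ ℚ.≤ p → 0ℚ ℚ.≤ q → 0ℚ ℚ.≤ p ℚ.+ q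
0≤p+q = ℚ.+-mono-≤

*-mono-≤ : ∀ {p q r s} → 0ℚ ℚ.≤ p → 0ℚ ℚ.≤ r → p ℚ.≤ q → r ℚ.≤ s → p ℚ.* r ℚ.≤ q ℚ.* s
*-mono-≤ {p} {q} {r} {s} 0≤p 0≤r p≤q r≤s = ℚ.≤-trans
  (ℚ.*-monoʳ-≤-nonNeg r {{ℚ.nonNegative 0≤r}} p≤q)
  (ℚ.*-monoˡ-≤-nonNeg q {{ℚ.nonNegative (ℚ.≤-trans 0≤p p≤q)}} r≤s)

0≤p*q : ∀ {p q} → 0ℚ ℚ.≤ p → 0ℚ ℚ.≤ q → 0ℚ ℚ.≤ p ℚ.* q
0≤p*q = *-mono-≤ ℚ.≤-refl ℚ.≤-refl

p≤q⇒0≤q-p : ∀ {p q} → p ℚ.≤ q → 0ℚ ℚ.≤ q ℚ.- p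
p≤q⇒0≤q-p {p} {q} p≤q =
  subst (ℚ._≤ q ℚ.- p) (ℚ.+-inverseʳ p) (ℚ.+-monoˡ-≤ (ℚ.- p) p≤q)

0≤q-p⇒p≤q : ∀ {p q} → 0ℚ ℚ.≤ q ℚ.- p → p ℚ.≤ q
0≤q-p⇒p≤q {p} {q} 0≤q-p = ℚ.≤-trans (ℚ.≤-reflexive (sym (ℚ.+-identityˡ p)))
  (ℚ.≤-trans (ℚ.+-monoˡ-≤ p 0≤q-p)
    (ℚ.≤-reflexive (solve 2 (λ p q → (q :- p) :+ p := q) refl p q)))

Q-mono : ∀ {a a′ b b′} → 0ℚ ℚ.≤ a → 0ℚ ℚ.≤ b → a ℚ.≤ a′ → b ℚ.≤ b′ → Q a b ℚ.≤ Q a′ b′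
Q-mono 0≤a 0≤b a≤a′ b≤b′ = ℚ.+-monoʳ-≤ 12ℚ (ℚ.+-mono-≤
  (ℚ.*-monoˡ-≤-nonNeg 8ℚ (ℚ.+-mono-≤ a≤a′ b≤b′))
  (ℚ.+-mono-≤ (ℚ.+-mono-≤ (*-mono-≤ 0≤a 0≤a a≤a′ a≤a′) (*-mono-≤ 0≤a 0≤b a≤a′ b≤b′))
    (*-mono-≤ 0≤b 0≤b b≤b′ b≤b′)))

-- On nonnegative arguments `Q` is at least `Q 0ℚ 0ℚ` = 12, so `P` does not shrink distances.
-- Smallness of `P` thus forces closeness, which yields both the Cauchy property of `R` and
-- uniqueness.
∣a-b∣≤∣Pa-Pb∣ : ∀ {a b} → 0ℚ ℚ.≤ a → 0ℚ ℚ.≤ b → ∣ a ℚ.- b ∣ ℚ.≤ ∣ P a ℚ.- P b ∣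
∣a-b∣≤∣Pa-Pb∣ {a} {b} 0≤a 0≤b = begin
  ∣ a ℚ.- b ∣                    ≡⟨ ℚ.*-identityʳ ∣ a ℚ.- b ∣ ⟨
  ∣ a ℚ.- b ∣ ℚ.* 1ℚ             ≤⟨ ℚ.*-monoˡ-≤-nonNeg ∣ a ℚ.- b ∣ {{ℚ.nonNegative (ℚ.0≤∣p∣ (a ℚ.- b))}} 1≤Q ⟩
  ∣ a ℚ.- b ∣ ℚ.* Q a b          ≡⟨ cong (∣ a ℚ.- b ∣ ℚ.*_) (ℚ.0≤p⇒∣p∣≡p (ℚ.≤-trans (ℚ.nonNegative⁻¹ 1ℚ) 1≤Q)) ⟨
  ∣ a ℚ.- b ∣ ℚ.* ∣ Q a b ∣      ≡⟨ ℚ.∣p*q∣≡∣p∣*∣q∣ (a ℚ.- b) (Q a b) ⟨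
  ∣ (a ℚ.- b) ℚ.* Q a b ∣        ≡⟨ cong ∣_∣ (P-difference a b) ⟨
  ∣ P a ℚ.- P b ∣                ∎
  where
  open ℚ.≤-Reasoning
  1≤Q : 1ℚ ℚ.≤ Q a b
  1≤Q = ℚ.≤-trans (from-yes (1ℚ ℚ.≤? Q 0ℚ 0ℚ)) (Q-mono ℚ.≤-refl ℚ.≤-refl 0≤a 0≤b)

-- 4 + lo = 4.9666… and 4 + hi = 4.96739… enclose R = 4.96736….
lo hi : ℚ
lo = + 29 / 30
hi = + 89 / 92

-- A chord step of slope 32; it multiplies P a by 1 − Q/32, which lies in [0, ½]
-- because 16 ≤ Q ≤ 32 on [½, 1].
improve : ℚ → ℚ
improve a = a ℚ.- P a ℚ.* 1/32

contraction : ℚ → ℚ → ℚ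
contraction a b = 1ℚ ℚ.- Q a b ℚ.* 1/32

record Approximation (a : ℚ) : Set where
  field
    lo≤  : lo ℚ.≤ a
    ≤hi  : a ℚ.≤ hi
    0≤-P : 0ℚ ℚ.≤ ℚ.- P a

0≤contraction : ∀ {a b} → lo ℚ.≤ a → lo ℚ.≤ b → a ℚ.≤ hi → b ℚ.≤ hi → 0ℚ ℚ.≤ contraction a b
0≤contraction lo≤a lo≤b a≤hi b≤hi = p≤q⇒0≤q-p (ℚ.≤-trans
  (ℚ.*-monoʳ-≤-nonNeg 1/32 (Q-mono (ℚ.≤-trans 0≤lo lo≤a) (ℚ.≤-trans 0≤lo lo≤b)
    (ℚ.≤-trans a≤hi hi≤1) (ℚ.≤-trans b≤hi hi≤1)))
  (from-yes (Q 1ℚ 1ℚ ℚ.* 1/32 ℚ.≤? 1ℚ)))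
  where
  0≤lo : 0ℚ ℚ.≤ lo
  0≤lo = from-yes (0ℚ ℚ.≤? lo)
  hi≤1 : hi ℚ.≤ 1ℚ
  hi≤1 = from-yes (hi ℚ.≤? 1ℚ)

contraction≤½ : ∀ {a b} → lo ℚ.≤ a → lo ℚ.≤ b → contraction a b ℚ.≤ ½
contraction≤½ {a} {b} lo≤a lo≤b = ℚ.≤-trans
  (ℚ.+-monoʳ-≤ 1ℚ (ℚ.neg-antimono-≤ (ℚ.*-monoʳ-≤-nonNeg 1/32 (Q-mono 0≤½ 0≤½
    (ℚ.≤-trans ½≤lo lo≤a) (ℚ.≤-trans ½≤lo lo≤b)))))
  (from-yes (contraction ½ ½ ℚ.≤? ½))
  where
  0≤½ : 0ℚ ℚ.≤ ½
  0≤½ = ℚ.nonNegative⁻¹ ½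
  ½≤lo : ½ ℚ.≤ lo
  ½≤lo = from-yes (½ ℚ.≤? lo)

-P-improve : ∀ a → ℚ.- P (improve a) ≡ (ℚ.- P a) ℚ.* contraction (improve a) a
-P-improve a = trans
  (solve 2 (λ p q → :- q := :- p :+ :- (q :- p)) refl (P a) (P (improve a)))
  (trans (cong (λ d → ℚ.- P a ℚ.+ ℚ.- d) (P-difference (improve a) a))
    (solve 4 (λ a p q d → :- p :+ :- ((a :- p :* d :- a) :* q) := :- p :* (con 1ℚ :- q :* d)) refl
      a (P a) (Q (improve a) a) 1/32))

-- The chord computation seen from `hi`. Since P is nonnegative at `hi`, both summands are
-- nonnegative for a ≤ `hi`, and a step cannot overshoot `hi`.
hi-improve : ∀ a → hi ℚ.- improve a ≡ (hi ℚ.- a) ℚ.* contraction hi a ℚ.+ P hi ℚ.* 1/32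
hi-improve a = trans
  (solve 5 (λ h a p q d → h :- (a :- p :* d) := (h :- a) :- (q :- p) :* d :+ q :* d) refl
    hi a (P a) (P hi) 1/32)
  (trans (cong (λ x → hi ℚ.- a ℚ.- x ℚ.* 1/32 ℚ.+ P hi ℚ.* 1/32) (P-difference hi a))
    (solve 5 (λ h a p q d → (h :- a) :- ((h :- a) :* q) :* d :+ p :* d
                           := (h :- a) :* (con 1ℚ :- q :* d) :+ p :* d) refl
      hi a (P hi) (Q hi a) 1/32))

-- The iteration climbs to the root from below: P a ≤ 0 makes the step go up, and a nonnegative
-- contraction factor keeps the sign of P.
improve-approximation : ∀ {a} → Approximation a → Approximation (improve a)
improve-approximation {a} approx = record { lo≤ = lo≤a′ ; ≤hi = a′≤hi ; 0≤-P = 0≤-Pa′ }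
  where
  open Approximation approx
  lo≤a′ : lo ℚ.≤ improve a
  lo≤a′ = ℚ.≤-trans lo≤ (0≤q-p⇒p≤q (subst (0ℚ ℚ.≤_)
    (solve 3 (λ a p d → :- p :* d := a :- p :* d :- a) refl a (P a) 1/32)
    (0≤p*q 0≤-P (ℚ.nonNegative⁻¹ 1/32))))
  a′≤hi : improve a ℚ.≤ hi
  a′≤hi = 0≤q-p⇒p≤q (subst (0ℚ ℚ.≤_) (sym (hi-improve a)) (0≤p+q
    (0≤p*q (p≤q⇒0≤q-p ≤hi) (0≤contraction (from-yes (lo ℚ.≤? hi)) lo≤ ℚ.≤-refl ≤hi))
    (from-yes (0ℚ ℚ.≤? P hi ℚ.* 1/32))))
  0≤-Pa′ : 0ℚ ℚ.≤ ℚ.- P (improve a)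
  0≤-Pa′ = subst (0ℚ ℚ.≤_) (sym (-P-improve a))
    (0≤p*q 0≤-P (0≤contraction lo≤a′ lo≤ a′≤hi ≤hi))

-P-halves : ∀ {a} → Approximation a → ℚ.- P (improve a) ℚ.≤ (ℚ.- P a) ℚ.* ½
-P-halves {a} approx = ℚ.≤-trans (ℚ.≤-reflexive (-P-improve a))
  (ℚ.*-monoˡ-≤-nonNeg (ℚ.- P a) {{ℚ.nonNegative 0≤-P}}
    (contraction≤½ (Approximation.lo≤ (improve-approximation approx)) lo≤))
  where open Approximation approx

approximant : ℕ → ℚ
approximant zero    = lo
approximant (suc n) = improve (approximant n)

approximation : ∀ n → Approximation (approximant n)
approximation zero    = record
  { lo≤ = ℚ.≤-refl ; ≤hi = from-yes (lo ℚ.≤? hi) ; 0≤-P = from-yes (0ℚ ℚ.≤? ℚ.- P lo) }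
approximation (suc n) = improve-approximation (approximation n)

-- Halving gives geometric decay, but the weaker rate 1/(n + 1) is enough for the Archimedean
-- argument; it survives the induction because n + 2 ≤ 2(n + 1).
-P-decay : ∀ n → (ℚ.- P (approximant n)) ℚ.* ι (suc n) ℚ.≤ 1ℚ
-P-decay zero    = from-yes ((ℚ.- P lo) ℚ.* ι 1 ℚ.≤? 1ℚ)
-P-decay (suc n) = begin
  (ℚ.- P (approximant (suc n))) ℚ.* ι (2 ℕ.+ n)
    ≤⟨ *-mono-≤ (Approximation.0≤-P (approximation (suc n))) (0≤ι (2 ℕ.+ n))
         (-P-halves (approximation n)) (ℚ.+-monoˡ-≤ (ι (suc n)) (ι-mono-≤ {1} {suc n} (s≤s z≤n))) ⟩
  (ℚ.- P (approximant n)) ℚ.* ½ ℚ.* (ι (suc n) ℚ.+ ι (suc n))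
    ≡⟨ solve 2 (λ g m → g :* con ½ :* (m :+ m) := g :* m) refl (ℚ.- P (approximant n)) (ι (suc n)) ⟩
  (ℚ.- P (approximant n)) ℚ.* ι (suc n)
    ≤⟨ -P-decay n ⟩
  1ℚ ∎
  where open ℚ.≤-Reasoning

P-vanishes : ∀ ε → 0ℚ ℚ.< ε → ∃ λ N → ∀ n → N ℕ.≤ n → ∣ P (approximant n) ∣ ℚ.< ε
P-vanishes ε 0<ε with N , 1≤Nε ← archimedean ε {{ℚ.positive 0<ε}} = N , λ n N≤n →
  let open ℚ.≤-Reasoning in
  ℚ.*-cancelʳ-<-nonNeg (ι (suc n)) {{ℚ.nonNegative (0≤ι (suc n))}} (begin-strict
    ∣ P (approximant n) ∣ ℚ.* ι (suc n)      ≡⟨ cong (ℚ._* ι (suc n)) (∣P∣≡-P n) ⟩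
    (ℚ.- P (approximant n)) ℚ.* ι (suc n)    ≤⟨ -P-decay n ⟩
    1ℚ                                       ≤⟨ 1≤Nε ⟩
    ι N ℚ.* ε                                ≤⟨ ℚ.*-monoʳ-≤-nonNeg ε {{ℚ.nonNegative (ℚ.<⇒≤ 0<ε)}} (ι-mono-≤ N≤n) ⟩
    ι n ℚ.* ε                                <⟨ ℚ.*-monoˡ-<-pos ε {{ℚ.positive 0<ε}} (ι-<-suc n) ⟩
    ι (suc n) ℚ.* ε                          ≡⟨ ℚ.*-comm (ι (suc n)) ε ⟩
    ε ℚ.* ι (suc n)                          ∎)
  where
  ι-<-suc : ∀ n → ι n ℚ.< ι (suc n)
  ι-<-suc n = subst (ℚ._< ι (suc n)) (ℚ.+-identityˡ (ι n)) (ℚ.+-monoˡ-< (ι n) (ℚ.positive⁻¹ 1ℚ))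
  ∣P∣≡-P : ∀ n → ∣ P (approximant n) ∣ ≡ ℚ.- P (approximant n)
  ∣P∣≡-P n = trans (sym (ℚ.∣-p∣≡∣p∣ (P (approximant n))))
    (ℚ.0≤p⇒∣p∣≡p (Approximation.0≤-P (approximation n)))

0≤approximant : ∀ n → 0ℚ ℚ.≤ approximant n
0≤approximant n = ℚ.≤-trans (from-yes (0ℚ ℚ.≤? lo)) (Approximation.lo≤ (approximation n))

∣a-b∣<ε : ∀ {a b} ε → 0ℚ ℚ.≤ a → 0ℚ ℚ.≤ b → ∣ P a ∣ ℚ.< ½ ℚ.* ε → ∣ P b ∣ ℚ.< ½ ℚ.* ε →
  ∣ a ℚ.- b ∣ ℚ.< ε
∣a-b∣<ε {a} {b} ε 0≤a 0≤b Pa<ε/2 Pb<ε/2 = begin-strict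
  ∣ a ℚ.- b ∣                ≤⟨ ∣a-b∣≤∣Pa-Pb∣ 0≤a 0≤b ⟩
  ∣ P a ℚ.- P b ∣            ≤⟨ ℚ.∣p-q∣≤∣p∣+∣q∣ (P a) (P b) ⟩
  ∣ P a ∣ ℚ.+ ∣ P b ∣        <⟨ ℚ.+-mono-< Pa<ε/2 Pb<ε/2 ⟩
  ½ ℚ.* ε ℚ.+ ½ ℚ.* ε        ≡⟨ half+half ε ⟩
  ε                          ∎
  where open ℚ.≤-Reasoning

R : ℝ
R = mkℝ (λ n → 4ℚ ℚ.+ approximant n) λ ε 0<ε →
  let N , small = P-vanishes (½ ℚ.* ε) (half-pos 0<ε) in
  N , λ m n N≤m N≤n → subst (λ d → ∣ d ∣ ℚ.< ε)
    (solve 3 (λ f a b → a :- b := (f :+ a) :- (f :+ b)) refl 4ℚ (approximant m) (approximant n))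
    (∣a-b∣<ε ε (0≤approximant m) (0≤approximant n) (small m N≤m) (small n N≤n))

R-root : R ^ 3 ≃ 4ℝ * (R ^ 2 + R + 1ℝ)
R-root ε 0<ε with N , small ← P-vanishes ε 0<ε = N , λ n N≤n →
  subst (λ p → ∣ p ∣ ℚ.< ε) (sym (cubic-4+ (approximant n))) (small n N≤n)

0≤square : ∀ p → 0ℚ ℚ.≤ p ℚ.* p
0≤square p with ℚ.≤-total 0ℚ p
... | inj₁ 0≤p = 0≤p*q 0≤p 0≤p
... | inj₂ p≤0 = subst (0ℚ ℚ.≤_) (solve 1 (λ p → (:- p) :* (:- p) := p :* p) refl p)
                   (0≤p*q (ℚ.neg-antimono-≤ p≤0) (ℚ.neg-antimono-≤ p≤0))

-- With x = 4 + a, the difference -P a - 3 equals -x³ + (2x + 1)² and also (4 - x)x² + 4x + 1. The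
-- first form is nonnegative for x ≤ 0, the second for 0 ≤ x ≤ 4.
3≤-P : ∀ {a} → a ℚ.≤ 0ℚ → + 3 / 1 ℚ.≤ ℚ.- P a
3≤-P {a} a≤0 with ℚ.≤-total (4ℚ ℚ.+ a) 0ℚ
... | inj₁ x≤0 = 0≤q-p⇒p≤q (subst (0ℚ ℚ.≤_) (identity a)
        (0≤p+q (0≤p*q 0≤-x (0≤p*q 0≤-x 0≤-x)) (0≤square (ι 2 ℚ.* x ℚ.+ 1ℚ))))
  where
  x = 4ℚ ℚ.+ a
  0≤-x : 0ℚ ℚ.≤ ℚ.- x
  0≤-x = ℚ.neg-antimono-≤ x≤0
  identity : ∀ a → let x = 4ℚ ℚ.+ a in
    (ℚ.- x) ℚ.* ((ℚ.- x) ℚ.* (ℚ.- x)) ℚ.+ (ι 2 ℚ.* x ℚ.+ 1ℚ) ℚ.* (ι 2 ℚ.* x ℚ.+ 1ℚ)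
    ≡ (ℚ.- P a) ℚ.- (+ 3 / 1)
  identity = solve 1 (λ a → let x = con 4ℚ :+ a; y = con (ι 2) :* x :+ con 1ℚ in
    (:- x) :* ((:- x) :* (:- x)) :+ y :* y
    := (:- (a :* (a :* (a :+ con 8ℚ) :+ con 12ℚ) :- con 20ℚ)) :- con (+ 3 / 1)) refl
... | inj₂ 0≤x = 0≤q-p⇒p≤q (subst (0ℚ ℚ.≤_) (identity a)
        (0≤p+q (0≤p+q (0≤p*q 0≤-a (0≤p*q 0≤x 0≤x)) (0≤p*q (from-yes (0ℚ ℚ.≤? 4ℚ)) 0≤x))
               (ℚ.nonNegative⁻¹ 1ℚ)))
  where
  0≤-a : 0ℚ ℚ.≤ ℚ.- a
  0≤-a = ℚ.neg-antimono-≤ a≤0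
  identity : ∀ a → let x = 4ℚ ℚ.+ a in
    (ℚ.- a) ℚ.* (x ℚ.* x) ℚ.+ 4ℚ ℚ.* x ℚ.+ 1ℚ ≡ (ℚ.- P a) ℚ.- (+ 3 / 1)
  identity = solve 1 (λ a → let x = con 4ℚ :+ a in
    (:- a) :* (x :* x) :+ con 4ℚ :* x :+ con 1ℚ
    := (:- (a :* (a :* (a :+ con 8ℚ) :+ con 12ℚ) :- con 20ℚ)) :- con (+ 3 / 1)) refl

root-unique : ∀ x → x ^ 3 ≃ 4ℝ * (x ^ 2 + x + 1ℝ) → x ≃ R
root-unique x root ε 0<ε
  -- Tolerance 1 keeps the terms of x eventually at 4 or above, since below 4 the cubic is at most
  -- -3. There the two tolerances ε/2, for x and for `R`, bound the distance.
  with N₁ , x-root ← root 1ℚ (ℚ.positive⁻¹ 1ℚ)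
     | N₂ , x-small ← root (½ ℚ.* ε) (half-pos 0<ε)
     | N₃ , R-small ← P-vanishes (½ ℚ.* ε) (half-pos 0<ε)
  = N₁ ⊔ (N₂ ⊔ N₃) , λ n n≥ →
    let n≥N₂₃ = ℕ.m⊔n≤o⇒n≤o N₁ (N₂ ⊔ N₃) n≥ in
    subst (λ d → ∣ d ∣ ℚ.< ε)
      (solve 3 (λ f x a → (x :- f) :- a := x :- (f :+ a)) refl 4ℚ (seq x n) (approximant n))
      (∣a-b∣<ε ε
        (0≤x-4 n (subst (λ p → ∣ p ∣ ℚ.< 1ℚ) (cubic-x n) (x-root n (ℕ.m⊔n≤o⇒m≤o N₁ (N₂ ⊔ N₃) n≥))))
        (0≤approximant n)
        (subst (λ p → ∣ p ∣ ℚ.< ½ ℚ.* ε) (cubic-x n) (x-small n (ℕ.m⊔n≤o⇒m≤o N₂ N₃ n≥N₂₃)))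
        (R-small n (ℕ.m⊔n≤o⇒n≤o N₂ N₃ n≥N₂₃)))
  where
  cubic-x : ∀ n → cubic (seq x n) ≡ P (seq x n ℚ.- 4ℚ)
  cubic-x n = trans
    (cong cubic (solve 2 (λ f x → x := f :+ (x :- f)) refl 4ℚ (seq x n)))
    (cubic-4+ (seq x n ℚ.- 4ℚ))
  p≤∣p∣ : ∀ p → p ℚ.≤ ∣ p ∣
  p≤∣p∣ p with ℚ.≤-total 0ℚ p
  ... | inj₁ 0≤p = ℚ.≤-reflexive (sym (ℚ.0≤p⇒∣p∣≡p 0≤p))
  ... | inj₂ p≤0 = ℚ.≤-trans p≤0 (ℚ.0≤∣p∣ p)
  0≤x-4 : ∀ n → ∣ P (seq x n ℚ.- 4ℚ) ∣ ℚ.< 1ℚ → 0ℚ ℚ.≤ seq x n ℚ.- 4ℚ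
  0≤x-4 n ∣P∣<1 with ℚ.≤-total 0ℚ (seq x n ℚ.- 4ℚ)
  ... | inj₁ 0≤a = 0≤a
  ... | inj₂ a≤0 = contradiction refl (ℚ.<⇒≢ (begin-strict
    1ℚ                                   <⟨ from-yes (1ℚ ℚ.<? + 3 / 1) ⟩
    + 3 / 1                              ≤⟨ 3≤-P a≤0 ⟩
    ℚ.- P (seq x n ℚ.- 4ℚ)               ≤⟨ p≤∣p∣ _ ⟩
    ∣ ℚ.- P (seq x n ℚ.- 4ℚ) ∣           ≡⟨ ℚ.∣-p∣≡∣p∣ (P (seq x n ℚ.- 4ℚ)) ⟩
    ∣ P (seq x n ℚ.- 4ℚ) ∣               <⟨ ∣P∣<1 ⟩
    1ℚ                                   ∎))
    where open ℚ.≤-Reasoning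

-- Numerical bounds on the root

fromℚ-< : ∀ {p q} x → p ℚ.< q → (∀ n → q ℚ.≤ seq x n) → fromℚ p < x
-- A rational strictly between p and q supplies a uniform gap m - p and still leaves the required
-- inequality strict.
fromℚ-< {p} {q} x p<q q≤x with m , p<m , m<q ← ℚ.<-dense p<q =
  m ℚ.- p
  , subst (ℚ._< m ℚ.- p) (ℚ.+-inverseʳ p) (ℚ.+-monoˡ-< (ℚ.- p) p<m)
  , 0 , λ n _ → ℚ.<-≤-trans
      (subst (ℚ._< q) (solve 2 (λ p m → m := p :+ (m :- p)) refl p m) m<q) (q≤x n)

<-fromℚ : ∀ {p q} x → p ℚ.< q → (∀ n → seq x n ℚ.≤ p) → x < fromℚ q
<-fromℚ {p} {q} x p<q x≤p =
  let ε , 0<ε , N , p+ε<q = fromℚ-< {p} (fromℚ q) p<q (λ _ → ℚ.≤-refl) in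
  ε , 0<ε , N , λ n N≤n → ℚ.≤-<-trans (ℚ.+-monoˡ-≤ ε (x≤p n)) (p+ε<q n N≤n)

R-lower : fromℚ (+ 49665 / 10000) < R
R-lower = fromℚ-< R (from-yes (+ 49665 / 10000 ℚ.<? 4ℚ ℚ.+ lo))
  λ n → ℚ.+-monoʳ-≤ 4ℚ (Approximation.lo≤ (approximation n))

R-upper : R < fromℚ (+ 49675 / 10000)
R-upper = <-fromℚ R (from-yes (4ℚ ℚ.+ hi ℚ.<? + 49675 / 10000))
  λ n → ℚ.+-monoʳ-≤ 4ℚ (Approximation.≤hi (approximation n))

-- The adversary

-- The order on `ℝ` is not decidable, so the adversary uses integer weights only and all its
-- comparisons take place in `ℕ`.
Natural : Edge → Set
Natural e = ∃ λ n → ∀ k → seq (weight e) k ≡ ι n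

natWeight : ∀ {σ} → All Natural σ → Subset (length σ) → ℕ
natWeight []            []            = 0
natWeight ((n , _) ∷ w) (inside  ∷ M) = n ℕ.+ natWeight w M
natWeight (_       ∷ w) (outside ∷ M) = natWeight w M

seq-totalWeight : ∀ {σ} (w : All Natural σ) M k →
  seq (totalWeight σ M) k ≡ ι (natWeight w M)
seq-totalWeight []             []            k = refl
seq-totalWeight ((n , eq) ∷ w) (inside  ∷ M) k =
  trans (cong₂ ℚ._+_ (eq k) (seq-totalWeight w M k)) (sym (ι-homo-+ n (natWeight w M)))
seq-totalWeight (_ ∷ w)        (outside ∷ M) k = seq-totalWeight w M k

natWeight-mono : ∀ {σ} (w : All Natural σ) {M N} → M ⊆ N → natWeight w M ℕ.≤ natWeight w N
natWeight-mono []            {[]}          {[]}          M⊆N = z≤n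
natWeight-mono ((n , _) ∷ w) {inside  ∷ M} {inside  ∷ N} M⊆N =
  ℕ.+-monoʳ-≤ n (natWeight-mono w (drop-∷-⊆ M⊆N))
natWeight-mono (_ ∷ w)       {inside  ∷ M} {outside ∷ N} M⊆N with () ← M⊆N here
natWeight-mono ((n , _) ∷ w) {outside ∷ M} {inside  ∷ N} M⊆N =
  ℕ.≤-trans (natWeight-mono w (drop-∷-⊆ M⊆N)) (ℕ.m≤n+m _ n)
natWeight-mono (_ ∷ w)       {outside ∷ M} {outside ∷ N} M⊆N =
  natWeight-mono w (drop-∷-⊆ M⊆N)

natWeight-⊥ : ∀ {σ} (w : All Natural σ) → natWeight w Subset.⊥ ≡ 0
natWeight-⊥ []      = refl
natWeight-⊥ (_ ∷ w) = natWeight-⊥ w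

edge : ∀ {a b} → a ℕ.< b → ℕ → Edge
edge a<b n = mkEdge _ _ a<b (fromℚ (ι n)) λ (ε , 0<ε , N , ι+ε<0) →
  ℚ.<-irrefl refl (ℚ.<-≤-trans (ι+ε<0 N ℕ.≤-refl) (ℚ.+-mono-≤ (0≤ι n) (ℚ.<⇒≤ 0<ε)))

record Board : Set where
  field
    σ       : Input
    weights : All Natural σ
    simple  : IsSimple σ
    next    : ℕ
    fresh   : All (λ e → v e ℕ.< next) σ

  next-fresh : ∀ i → ¬ (next ∈ᵉ lookup σ i)
  next-fresh i = [ ℕ.>⇒≢ (ℕ.<-trans (u<v (lookup σ i)) v<next) , ℕ.>⇒≢ v<next ]
    where v<next = All.lookup fresh (∈-lookup i)

open Board

-- A new edge always joins an old vertex to the fresh vertex `next B`.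
present : ∀ B {z} → z ℕ.< next B → ℕ → Board
present B z<x n = record
  { σ       = edge z<x n ∷ σ B
  ; weights = (n , λ _ → refl) ∷ weights B
  ; simple  = All.map (λ v<x (_ , x≡v) → ℕ.>⇒≢ v<x x≡v) (fresh B) ∷ simple B
  ; next    = suc (next B)
  ; fresh   = ℕ.≤-refl ∷ All.map ℕ.m<n⇒m<1+n (fresh B)
  }

Nowhere : ℕ → Set
Nowhere _ = ⊥

-- A certificate that a matching of weight at least m exists. `Avoided` collects vertices it leaves
-- free, where later edges may extend it.
record Matched (B : Board) (Avoided : ℕ → Set) (m : ℕ) : Set where
  field
    M          : Subset (length (σ B))
    isMatching : IsMatching (σ B) M
    avoids     : ∀ {i y} → i ∈ M → Avoided y → ¬ (y ∈ᵉ lookup (σ B) i)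
    heavy      : m ℕ.≤ natWeight (weights B) M

weaken : ∀ {B X Y m n} → (∀ {y} → Y y → X y) → n ℕ.≤ m → Matched B X m → Matched B Y n
weaken Y⊆X n≤m F = record
  { M = M ; isMatching = isMatching
  ; avoids = λ i∈M y∈Y → avoids i∈M (Y⊆X y∈Y)
  ; heavy  = ℕ.≤-trans n≤m heavy }
  where open Matched F

-- No old edge touches the fresh vertex, so it may join the avoided ones. Thus a matching that
-- avoids z also avoids both ends of the new edge, as the next round needs.
keep : ∀ {B X Y m n z} (z<x : z ℕ.< next B) → (∀ {y} → Y y → X y ⊎ y ≡ next B) →
  Matched B X m → Matched (present B z<x n) Y m
keep {B} {X} {Y} {n = n} z<x Y⊆X F = record
  { M = outside ∷ M ; isMatching = isMatching′ ; avoids = avoids′ ; heavy = heavy }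
  where
  open Matched F
  isMatching′ : IsMatching (σ (present B z<x n)) (outside ∷ M)
  isMatching′ (suc i) (suc j) (there i∈M) (there j∈M) i≢j = isMatching i j i∈M j∈M (i≢j ∘ cong suc)
  avoids′ : ∀ {i y} → i ∈ (outside ∷ M) → Y y → ¬ (y ∈ᵉ lookup (σ (present B z<x n)) i)
  avoids′ {suc i} (there i∈M) y∈Y with Y⊆X y∈Y
  ... | inj₁ y∈X   = avoids i∈M y∈X
  ... | inj₂ refl = next-fresh B i

extend : ∀ {B X Y m n z} (z<x : z ℕ.< next B) → X z →
  (∀ {y} → Y y → X y × y ≢ z × y ≢ next B) →
  Matched B X m → Matched (present B z<x n) Y (n ℕ.+ m)
extend {B} {X} {Y} {n = n} {z} z<x z∈X Y⊆X F = record
  { M = inside ∷ M ; isMatching = isMatching′ ; avoids = avoids′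
  ; heavy = ℕ.+-monoʳ-≤ n heavy }
  where
  open Matched F
  B′ = present B z<x n
  disjoint : ∀ {i} → i ∈ M → Disjoint (edge z<x n) (lookup (σ B) i)
  disjoint i∈M y (inj₁ refl) = avoids i∈M z∈X
  disjoint i∈M y (inj₂ refl) = next-fresh B _
  isMatching′ : IsMatching (σ B′) (inside ∷ M)
  isMatching′ zero    zero    _           _           i≢i = contradiction refl i≢i
  isMatching′ zero    (suc j) _           (there j∈M) _   = disjoint j∈M
  isMatching′ (suc i) zero    (there i∈M) _           _   = λ y y∈i y∈e → disjoint i∈M y y∈e y∈i
  isMatching′ (suc i) (suc j) (there i∈M) (there j∈M) i≢j =
    isMatching i j i∈M j∈M (i≢j ∘ cong suc)
  avoids′ : ∀ {i y} → i ∈ (inside ∷ M) → Y y → ¬ (y ∈ᵉ lookup (σ B′) i)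
  avoids′ {zero}  _           y∈Y = [ proj₁ (proj₂ (Y⊆X y∈Y)) , proj₂ (proj₂ (Y⊆X y∈Y)) ]
  avoids′ {suc i} (there i∈M) y∈Y = avoids i∈M (proj₁ (Y⊆X y∈Y))

module Adversary (A : OnlineAlgorithm) where

  -- The algorithm may hold e or nothing at all: dropping or rejecting e is covered, since w is only
  -- an upper bound. `H` is a parameter so that it can be matched on.
  record Holding (B : Board) (H : Subset (length (σ B))) (e : Edge) (w : ℕ) : Set where
    field
      only    : ∀ {i} → i ∈ H → lookup (σ B) i ≡ e
      output≤ : natWeight (weights B) H ℕ.≤ w
      v<next  : v e ℕ.< next B

  Holds : Board → Edge → ℕ → Set
  Holds B = Holding B (held A (σ B))

  -- The new edge meets e at z, so a matching containing it retains nothing older. If it is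
  -- rejected, irrevocability leaves a subset of what was held.
  response : ∀ {B e w z} (z<x : z ℕ.< next B) n → z ∈ᵉ e → Holds B e w →
    Holds (present B z<x n) (edge z<x n) n ⊎ Holds (present B z<x n) e w
  response {B} {e} {w} {z} z<x n z∈e H =
    respond (held A (σ B′)) (matching A (σ B′) (simple B′))
            (irrevocable A (edge z<x n) (σ B) (simple B′))
    where
    open Holding H
    B′ = present B z<x n
    respond : ∀ H′ → IsMatching (σ B′) H′ → Vec.tail H′ ⊆ held A (σ B) →
      Holding B′ H′ (edge z<x n) n ⊎ Holding B′ H′ e w
    respond (outside ∷ T) _ T⊆H = inj₂ record
      { only    = λ { {suc i} (there i∈T) → only (T⊆H i∈T) }
      ; output≤ = ℕ.≤-trans (natWeight-mono (weights B) T⊆H) output≤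
      ; v<next  = ℕ.m<n⇒m<1+n v<next }
    respond (inside ∷ T) isMatching T⊆H = inj₁ record
      { only    = λ { {zero}  _           → refl
                    ; {suc i} (there i∈T) → contradiction i∈T i∉T }
      ; output≤ = ℕ.≤-reflexive (trans
          (cong (n ℕ.+_) (ℕ.n≤0⇒n≡0 (ℕ.≤-trans
            (natWeight-mono (weights B) (λ i∈T → contradiction i∈T i∉T))
            (ℕ.≤-reflexive (natWeight-⊥ (weights B))))))
          (ℕ.+-identityʳ n))
      ; v<next  = ℕ.≤-refl }
      where
      i∉T : ∀ {i} → ¬ (i ∈ T)
      i∉T {i} i∈T = isMatching zero (suc i) here (there i∈T) (λ()) z (inj₁ refl)
        (subst (z ∈ᵉ_) (sym (only (T⊆H i∈T))) z∈e)

  Win : Set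
  Win = ∃ λ B → ∃ λ m → Matched B Nowhere m × 5 ℕ.* natWeight (weights B) (held A (σ B)) ℕ.< m

  win : ∀ {B e w m} → Holds B e w → Matched B Nowhere m → 5 ℕ.* w ℕ.< m → Win
  win H F 5w<m = _ , _ , F , ℕ.≤-<-trans (ℕ.*-monoʳ-≤ 5 (Holding.output≤ H)) 5w<m

  -- What the next round must deliver, with e the newly accepted edge. The inequalities record that
  -- neither F with two pendant edges nor F with the old edge has won. Taking this as an argument
  -- separates the recursion within a round from the recursion over rounds.
  Continuation : ℕ → ℕ → Set
  Continuation S w = ∀ {B e} t → t ℕ.+ (t ℕ.+ S) ℕ.≤ 5 ℕ.* w → w ℕ.+ S ℕ.≤ 5 ℕ.* suc t →
    Holds B e (suc t) → Matched B (_∈ᵉ e) (t ℕ.+ S) → Matched B Nowhere (suc t ℕ.+ (t ℕ.+ S)) →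
    Win

  -- Fᵤ and Fᵥ extend F by a rejected edge at the end of e they are not named after,
  -- Fᵤᵥ extends F at both ends, and Fₑ stands for F together with e.
  ladder : ∀ {e S w} → 0 ℕ.< w → Continuation S w →
    ∀ m t → 3 ℕ.* w ℕ.≤ t ℕ.+ m → ∀ {B} → Holds B e w →
    Matched B (_∈ᵉ e) S →
    Matched B (_≡ u e) (t ℕ.+ S) →
    Matched B (_≡ v e) (t ℕ.+ S) →
    Matched B Nowhere (t ℕ.+ (t ℕ.+ S)) →
    Matched B Nowhere (w ℕ.+ S) →
    Win
  ladder {e} {S} {w} 0<w continue m t 3w≤t+m {B} H F Fᵤ Fᵥ Fᵤᵥ Fₑ
    with 5 ℕ.* w ℕ.<? t ℕ.+ (t ℕ.+ S)
  ... | yes 5w< = win H Fᵤᵥ 5w<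
  -- The number m is fuel. When it runs out, t ≥ 3w, and two pendant edges alone weigh 6w > 5w, so
  -- the adversary would have won already.
  ladder {e} {S} {w} 0<w continue zero t 3w≤t+0 H F Fᵤ Fᵥ Fᵤᵥ Fₑ | no 5w≮ =
    contradiction (begin-strict
      5 ℕ.* w                  <⟨ ℕ.m<n+m (5 ℕ.* w) 0<w ⟩
      w ℕ.+ 5 ℕ.* w            ≡⟨ identity w ⟩
      3 ℕ.* w ℕ.+ 3 ℕ.* w      ≤⟨ ℕ.+-mono-≤ 3w≤t 3w≤t ⟩
      t ℕ.+ t                  ≤⟨ ℕ.+-monoʳ-≤ t (ℕ.m≤m+n t S) ⟩
      t ℕ.+ (t ℕ.+ S)          ∎) 5w≮
    where
    open ℕ.≤-Reasoning
    3w≤t = subst (3 ℕ.* w ℕ.≤_) (ℕ.+-identityʳ t) 3w≤t+0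
    identity : ∀ w → w ℕ.+ 5 ℕ.* w ≡ 3 ℕ.* w ℕ.+ 3 ℕ.* w
    identity = solve-∀
  ladder {e} {S} {w} 0<w continue (suc m) t 3w≤ {B} H F Fᵤ Fᵥ Fᵤᵥ Fₑ | no 5w≮ =
    first (response u<x (suc t) (inj₁ refl) H)
    where
    u<x : u e ℕ.< next B
    u<x = ℕ.<-trans (u<v e) (Holding.v<next H)
    B₁ = present B u<x (suc t)
    v<x : v e ℕ.< next B₁
    v<x = ℕ.m<n⇒m<1+n (Holding.v<next H)
    B₂ = present B₁ v<x (suc t)

    small : t ℕ.+ (t ℕ.+ S) ℕ.≤ 5 ℕ.* w
    small = ℕ.≮⇒≥ 5w≮

    Fₑ₁ : Matched B₁ Nowhere (w ℕ.+ S)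
    Fₑ₁ = keep u<x (λ()) Fₑ
    Fₑ₂ : Matched B₂ Nowhere (w ℕ.+ S)
    Fₑ₂ = keep v<x (λ()) Fₑ₁
    Fᵥ₁ : Matched B₁ (_≡ v e) (suc t ℕ.+ S)
    Fᵥ₁ = extend u<x (inj₁ refl)
      (λ { refl → inj₂ refl , ℕ.>⇒≢ (u<v e) , ℕ.<⇒≢ (Holding.v<next H) }) F

    second : Holds B₂ (edge v<x (suc t)) (suc t) ⊎ Holds B₂ e w → Win
    second (inj₁ H₂) with 5 ℕ.* suc t ℕ.<? w ℕ.+ S
    ... | yes 5t< = win H₂ Fₑ₂ 5t<
    ... | no  5t≮ = continue t small (ℕ.≮⇒≥ 5t≮) H₂ (keep v<x id F′) (extend v<x refl (λ()) F′)
      where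
      -- The rejected edge at `u e` already has weight t + 1. One unit is given up so that
      -- acceptance at either end leads to the same continuation.
      F′ : Matched B₁ (_≡ v e) (t ℕ.+ S)
      F′ = weaken id (ℕ.n≤1+n _) Fᵥ₁
    second (inj₂ H₂) = ladder 0<w continue m (suc t)
      (subst (3 ℕ.* w ℕ.≤_) (ℕ.+-suc t m) 3w≤) H₂
      (keep v<x inj₁ F₁)
      (extend v<x (inj₂ refl)
        (λ { refl → inj₁ refl , ℕ.<⇒≢ (u<v e) , ℕ.<⇒≢ (ℕ.m<n⇒m<1+n u<x) }) F₁)
      (keep v<x inj₁ Fᵥ₁)
      (extend v<x refl (λ()) Fᵥ₁)
      Fₑ₂
      where
      F₁ : Matched B₁ (_∈ᵉ e) S
      F₁ = keep u<x inj₁ F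

    first : Holds B₁ (edge u<x (suc t)) (suc t) ⊎ Holds B₁ e w → Win
    first (inj₁ H₁) with 5 ℕ.* suc t ℕ.<? w ℕ.+ S
    ... | yes 5t< = win H₁ Fₑ₁ 5t<
    ... | no  5t≮ = continue t small (ℕ.≮⇒≥ 5t≮) H₁ (keep u<x id Fᵤ) (extend u<x refl (λ()) Fᵤ)
    first (inj₂ H₁) = second (response v<x (suc t) (inj₂ refl) H₁)

  -- Here i rounds are done and n remain. As w loses at most a factor 5 per round, the bound 37 · 5ⁿ
  -- keeps w ≥ 37 whenever `gain` is applied.
  stage : ∀ n i → i ℕ.+ n ≡ 49 → ∀ {B e S w} → 37 ℕ.* 5 ℕ.^ n ℕ.≤ w → i ℕ.* w ℕ.≤ 12 ℕ.* S →
    Holds B e w → Matched B (_∈ᵉ e) S → Matched B Nowhere (w ℕ.+ S) → Win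
  stage zero i i+0≡49 {S = S} {w} 37≤w iw≤12S H F Fₑ
    with refl ← trans (sym (ℕ.+-identityʳ i)) i+0≡49 =
    -- Here 12(w + S) ≥ (12 + 49)w = 61w, just above 12 · 5w = 60w; this fixes the number 49.
    win H Fₑ (ℕ.*-cancelˡ-< 12 _ _ (begin-strict
      12 ℕ.* (5 ℕ.* w)         <⟨ ℕ.m<n+m _ (ℕ.<-≤-trans ℕ.z<s 37≤w) ⟩
      w ℕ.+ 12 ℕ.* (5 ℕ.* w)   ≡⟨ identity w ⟩
      12 ℕ.* w ℕ.+ 49 ℕ.* w    ≤⟨ ℕ.+-monoʳ-≤ (12 ℕ.* w) iw≤12S ⟩
      12 ℕ.* w ℕ.+ 12 ℕ.* S    ≡⟨ ℕ.*-distribˡ-+ 12 w S ⟨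
      12 ℕ.* (w ℕ.+ S)         ∎))
    where
    open ℕ.≤-Reasoning
    identity : ∀ w → w ℕ.+ 12 ℕ.* (5 ℕ.* w) ≡ 12 ℕ.* w ℕ.+ 49 ℕ.* w
    identity = solve-∀
  stage (suc n) i i+n≡49 {S = S} {w} w-large iw≤12S H F Fₑ =
    -- At t = 0 there are no pendant edges yet, and F itself serves as `Fᵤ`, `Fᵥ` and `Fᵤᵥ`.
    ladder (ℕ.<-≤-trans ℕ.z<s 37≤w) continue (3 ℕ.* w) 0 ℕ.≤-refl H F
      (weaken inj₁ ℕ.≤-refl F) (weaken inj₂ ℕ.≤-refl F) (weaken (λ()) ℕ.≤-refl F) Fₑ
    where
    37≤w : 37 ℕ.≤ w
    37≤w = ℕ.≤-trans (ℕ.*-monoʳ-≤ 37 (ℕ.m^n>0 5 (suc n))) w-large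
    continue : Continuation S w
    continue t 2t+S≤5w w+S≤5t⁺ H′ F′ Fₑ′ =
      stage n (suc i) (trans (sym (ℕ.+-suc i n)) i+n≡49) t⁺-large
        (subst (λ r → suc i ℕ.* suc t ℕ.≤ 12 ℕ.* r) (ℕ.+-comm S t)
          (Gain.gain i S w t 37≤w
            (subst (ℕ._≤ 5 ℕ.* w) (identity t S) 2t+S≤5w)
            (subst (ℕ._≤ 5 ℕ.* suc t) (ℕ.+-comm w S) w+S≤5t⁺) iw≤12S))
        H′ F′ Fₑ′
      where
      identity : ∀ t S → t ℕ.+ (t ℕ.+ S) ≡ S ℕ.+ (t ℕ.+ t)
      identity = solve-∀
      pull : ∀ p → 5 ℕ.* (37 ℕ.* p) ≡ 37 ℕ.* (5 ℕ.* p)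
      pull = solve-∀
      t⁺-large : 37 ℕ.* 5 ℕ.^ n ℕ.≤ suc t
      t⁺-large = ℕ.*-cancelˡ-≤ 5 (ℕ.≤-trans (ℕ.≤-reflexive (pull (5 ℕ.^ n)))
        (ℕ.≤-trans w-large (ℕ.≤-trans (ℕ.m≤m+n w S) w+S≤5t⁺)))

  -- The first round has F empty, so S = 0, and the ratio bound for i = 0 is trivial.
  opening : ∀ w → 37 ℕ.* 5 ℕ.^ 49 ℕ.≤ w → Win
  opening w w-large = stage 49 0 refl {B} {e} {0} {w} w-large z≤n
    (holding (held A (σ B)))
    (record { M = outside ∷ []
            ; isMatching = λ { zero zero () }
            ; avoids = λ { {zero} () }
            ; heavy = z≤n })
    (record { M = inside ∷ []
            ; isMatching = λ { zero zero _ _ i≢i → contradiction refl i≢i }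
            ; avoids = λ _ ()
            ; heavy = ℕ.≤-refl })
    where
    e : Edge
    e = edge {0} {1} ℕ.z<s w
    B : Board
    B = record
      { σ       = e ∷ []
      ; weights = (w , λ _ → refl) ∷ []
      ; simple  = [] ∷ []
      ; next    = 2
      ; fresh   = ℕ.≤-refl ∷ []
      }
    holding : ∀ H → Holding B H e w
    holding H@(inside ∷ []) = record
      { only = λ { {zero} _ → refl } ; output≤ = ℕ.≤-reflexive (ℕ.+-identityʳ w) ; v<next = ℕ.≤-refl }
    holding H@(outside ∷ []) = record
      { only = λ { {zero} () } ; output≤ = z≤n ; v<next = ℕ.≤-refl }

-- Maximum matchings

disjoint? : ∀ e f → Dec (Disjoint e f)
disjoint? e f = map′
  (λ { (u∉f , v∉f) x (inj₁ refl) → u∉f ; (u∉f , v∉f) x (inj₂ refl) → v∉f })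
  (λ disjoint → disjoint (u e) (inj₁ refl) , disjoint (v e) (inj₂ refl))
  (¬? (∈ᵉ? (u e)) ×-dec ¬? (∈ᵉ? (v e)))
  where
  ∈ᵉ? : ∀ x → Dec (x ∈ᵉ f)
  ∈ᵉ? x = (x ℕ.≟ u f) ⊎-dec (x ℕ.≟ v f)

isMatching? : ∀ σ M → Dec (IsMatching σ M)
isMatching? σ M = all? λ i → all? λ j → i ∈? M →-dec (j ∈? M →-dec
  (¬? (i Fin.≟ j) →-dec disjoint? (lookup σ i) (lookup σ j)))

-- The adversary exhibits a heavy matching, not a maximum one. A finite search replaces it by a
-- strictly heavier matching as long as one exists; the weight of the full edge set bounds the
-- number of replacements.
heaviest-above : ∀ {σ} (w : All Natural σ) M → IsMatching σ M → ∃ λ M* → IsMatching σ M* ×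
  natWeight w M ℕ.≤ natWeight w M* × (∀ M′ → IsMatching σ M′ → natWeight w M′ ℕ.≤ natWeight w M*)
heaviest-above {σ} w M isM = climb (natWeight w Subset.⊤) M isM (ℕ.m≤n+m _ (natWeight w M))
  where
  climb : ∀ d M → IsMatching σ M → natWeight w Subset.⊤ ℕ.≤ natWeight w M ℕ.+ d →
    ∃ λ M* → IsMatching σ M* × natWeight w M ℕ.≤ natWeight w M* ×
      (∀ M′ → IsMatching σ M′ → natWeight w M′ ℕ.≤ natWeight w M*)
  climb d M isM ⊤≤M+d
    with anySubset? (λ M′ → isMatching? σ M′ ×-dec (natWeight w M ℕ.<? natWeight w M′))
  ... | no none = M , isM , ℕ.≤-refl , λ M′ isM′ → ℕ.≮⇒≥ λ M<M′ → none (M′ , isM′ , M<M′)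
  climb zero M isM ⊤≤M+0 | yes (M′ , _ , M<M′) =
    contradiction (natWeight-mono w (⊆⊤ {p = M′}))
      (ℕ.<⇒≱ (ℕ.≤-<-trans (subst (natWeight w Subset.⊤ ℕ.≤_) (ℕ.+-identityʳ _) ⊤≤M+0) M<M′))
  climb (suc d) M isM ⊤≤M+1+d | yes (M′ , isM′ , M<M′)
    with M* , isM* , M′≤M* , max ← climb d M′ isM′ (ℕ.≤-trans
      (subst (natWeight w Subset.⊤ ℕ.≤_) (ℕ.+-suc _ d) ⊤≤M+1+d) (ℕ.+-monoˡ-≤ d M<M′))
    = M* , isM* , ℕ.≤-trans (ℕ.<⇒≤ M<M′) M′≤M* , max

-- Transfer from integer to real weights

totalWeight-mono : ∀ {σ} (w : All Natural σ) {M N} → natWeight w M ℕ.≤ natWeight w N →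
  totalWeight σ M ≤ totalWeight σ N
totalWeight-mono {σ} w {M} {N} M≤N (ε , 0<ε , k , N+ε<M) = ℚ.<-irrefl refl (begin-strict
  ι (natWeight w N)                ≡⟨ ℚ.+-identityʳ _ ⟨
  ι (natWeight w N) ℚ.+ 0ℚ         <⟨ ℚ.+-monoʳ-< (ι (natWeight w N)) 0<ε ⟩
  ι (natWeight w N) ℚ.+ ε          ≡⟨ cong (ℚ._+ ε) (seq-totalWeight w N k) ⟨
  seq (totalWeight σ N) k ℚ.+ ε    <⟨ N+ε<M k ℕ.≤-refl ⟩
  seq (totalWeight σ M) k          ≡⟨ seq-totalWeight w M k ⟩
  ι (natWeight w M)                ≤⟨ ι-mono-≤ M≤N ⟩
  ι (natWeight w N)                ∎)
  where open ℚ.≤-Reasoning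

-- From some index on, the terms of c lie below those of `R`, hence below 5. Integrality turns the
-- strict inequality into a gap of 1, which leaves ½ as the uniform gap.
*-totalWeight-< : ∀ {σ} (w : All Natural σ) {H M} c → c < R →
  5 ℕ.* natWeight w H ℕ.< natWeight w M → c * totalWeight σ H < totalWeight σ M
*-totalWeight-< {σ} w {H} {M} c (ε , 0<ε , N , c+ε<R) 5H<M = ½ , ℚ.positive⁻¹ ½ , N , λ n N≤n →
  begin-strict
  seq c n ℚ.* seq (totalWeight σ H) n ℚ.+ ½
    ≡⟨ cong (λ h → seq c n ℚ.* h ℚ.+ ½) (seq-totalWeight w H n) ⟩
  seq c n ℚ.* ι h ℚ.+ ½
    ≤⟨ ℚ.+-monoˡ-≤ ½ (ℚ.*-monoʳ-≤-nonNeg (ι h) {{ℚ.nonNegative (0≤ι h)}} (c≤5 n N≤n)) ⟩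
  ι 5 ℚ.* ι h ℚ.+ ½
    ≡⟨ cong (ℚ._+ ½) (ι-homo-* 5 h) ⟨
  ι (5 ℕ.* h) ℚ.+ ½
    <⟨ ℚ.+-monoʳ-< (ι (5 ℕ.* h)) (from-yes (½ ℚ.<? 1ℚ)) ⟩
  ι (5 ℕ.* h) ℚ.+ 1ℚ
    ≡⟨ ℚ.+-comm (ι (5 ℕ.* h)) 1ℚ ⟩
  ι (suc (5 ℕ.* h))
    ≤⟨ ι-mono-≤ 5H<M ⟩
  ι (natWeight w M)
    ≡⟨ seq-totalWeight w M n ⟨
  seq (totalWeight σ M) n ∎
  where
  open ℚ.≤-Reasoning
  h = natWeight w H
  c≤5 : ∀ n → N ℕ.≤ n → seq c n ℚ.≤ ι 5
  c≤5 n N≤n = begin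
    seq c n                  ≡⟨ ℚ.+-identityʳ (seq c n) ⟨
    seq c n ℚ.+ 0ℚ           ≤⟨ ℚ.+-monoʳ-≤ (seq c n) (ℚ.<⇒≤ 0<ε) ⟩
    seq c n ℚ.+ ε            <⟨ c+ε<R n N≤n ⟩
    4ℚ ℚ.+ approximant n     ≤⟨ ℚ.+-monoʳ-≤ 4ℚ (Approximation.≤hi (approximation n)) ⟩
    4ℚ ℚ.+ hi                ≤⟨ from-yes (4ℚ ℚ.+ hi ℚ.≤? ι 5) ⟩
    ι 5                      ∎

not-competitive : ∀ A c → c < R → ∃ λ (σ : Input) → IsSimple σ
  × ∃ λ M → IsMaximumMatching σ M × (c * totalWeight σ (held A σ) < totalWeight σ M)
not-competitive A c c<R = conclude (Adversary.opening A (37 ℕ.* 5 ℕ.^ 49) ℕ.≤-refl)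
  where
  conclude : Adversary.Win A → ∃ λ (σ : Input) → IsSimple σ
    × ∃ λ M → IsMaximumMatching σ M × (c * totalWeight σ (held A σ) < totalWeight σ M)
  conclude (B , m , F , 5H<m) =
    let open Matched F renaming (M to M₀)
        M , isM , M₀≤M , max = heaviest-above (weights B) M₀ isMatching
    in σ B , simple B , M
     , (isM , λ M′ isM′ → totalWeight-mono (weights B) (max M′ isM′))
     , *-totalWeight-< (weights B) c c<R (ℕ.<-≤-trans 5H<m (ℕ.≤-trans heavy M₀≤M))

theorem3p1 : ∃ λ (R : ℝ) →
    (R ^ 3 ≃ 4ℝ * (R ^ 2 + R + 1ℝ))
    × (∀ (x : ℝ) → x ^ 3 ≃ 4ℝ * (x ^ 2 + x + 1ℝ) → x ≃ R)
    × (fromℚ (+ 49665 / 10000) < R)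
    × (R < fromℚ (+ 49675 / 10000))
    × (∀ (A : OnlineAlgorithm) →
    CompetitiveRatio≥ A R
    × (∀ (c : ℝ) → c < R →
    ∃ λ (σ : Input) → IsSimple σ
    × ∃ λ M → IsMaximumMatching σ M
    × (c * totalWeight σ (held A σ) < totalWeight σ M)))
theorem3p1 = R , R-root , root-unique , R-lower , R-upper , λ A →
  ( (λ c competitive c<R →
      let σ , simple , M , maximum , exceeds = not-competitive A c c<R in
      competitive σ simple M maximum exceeds)
  , not-competitive A )
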